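{- Let $\theta=\phi(D)$ be a delta operator with poweroids $x^{\{n\}}$ and let $\eta=\phi^{ -1}(D)$. Put $e(x,t)=e^{x\eta}e^{0\cdot t}=\sum_{n\ge0}x^{\{n\}}\,t^n/n!$. Then $$e(x,t)\,e(y,t)=e(x+y,t),$$ equivalently the poweroids have the binomial property: for all $n\ge0$, $$(x+y)^{\{n\}}=\sum_{k=0}^n\binom nk\,x^{\{k\}}\,y^{\{n-k\}} .$$
   Context: Work with polynomials (real or complex coefficients); $D$ is differentiation. A delta operator is $\theta=\phi(D)$, where $\phi(t)=\sum_{\nu\ge1}k_\nu t^\nu$ is a formal power series with $k_1=1$; $\phi^{ -1}$ is its compositional inverse. The poweroids $x^{\{n\}}$ of $\theta$ are the unique polynomials with $x^{\{0\}}=1$, $\theta x^{\{n\}}=n\,x^{\{n-1\}}$ for $n\ge1$, and $x^{\{n\}}|_{x=0}=0$ for $n\ge1$; $(x+y)^{\{n\}}$ is the polynomial $x^{\{n\}}$ evaluated at $x+y$. For a formal power series $f$, $f(\eta)0^n=\big(f(\phi^{ -1}(D_z))z^n\big)|_{z=0}$, and $f(\eta)e^{0\cdot t}=\sum_{n\ge0}\big(f(\eta)0^n\big)t^n/n!$; in $e^{x\eta}$, $x$ is a parameter. All series are formal power series in $t$. -}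

module Defs where

open import Algebra.Apartness.Bundles using (HeytingField; HeytingCommutativeRing)
open import Algebra.Bundles using (CommutativeRing)
import Algebra.Properties.Semiring.Exp as Exp
import Algebra.Properties.Semiring.Mult as Mult
import Algebra.Properties.Semiring.Sum as Sum
open import Data.Fin.Base using (toℕ)
open import Data.List.Base using (List; []; _∷_; _++_; length; map; foldr; replicate; applyUpTo)
open import Data.Nat.Base using (ℕ; zero; suc; _∸_)
open import Data.Nat.GeneralisedArithmetic using (iterate)
open import Data.Product.Base using (proj₁)

-- The standard library has no ℝ or ℂ; the scalars are an arbitrary Heyting
-- field of characteristic zero.

module FieldNotation {c ℓ₁ ℓ₂} (K : HeytingField c ℓ₁ ℓ₂) where
  open HeytingField K public
    using (Carrier; _≈_; _#_; _+_; _*_; 0#; 1#; #⇒invertible)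

  commutativeRing : CommutativeRing c ℓ₁
  commutativeRing = HeytingCommutativeRing.commutativeRing (HeytingField.heytingCommutativeRing K)

  open CommutativeRing commutativeRing using (semiring)
  open Exp semiring public using (_^_)
  open Mult semiring public using () renaming (_×_ to _·_)
  open Sum semiring public using (sum-syntax; sum⁺-syntax)

CharacteristicZero : ∀ {c ℓ₁ ℓ₂} → HeytingField c ℓ₁ ℓ₂ → Set ℓ₂
CharacteristicZero K = ∀ n → (suc n · 1#) # 0#
  where open FieldNotation K

module Poweroids {c ℓ₁ ℓ₂} (K : HeytingField c ℓ₁ ℓ₂) (char0 : CharacteristicZero K) where
  open FieldNotation K public

  1/[1+_] : ℕ → Carrier
  1/[1+ n ] = proj₁ (#⇒invertible (char0 n))

  1/_! : ℕ → Carrier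
  1/ zero  ! = 1#
  1/ suc n ! = 1/[1+ n ] * 1/ n !

  -- Formal power series: f n is the ordinary coefficient of tⁿ.

  Series : Set c
  Series = ℕ → Carrier

  infix 4 _≈ₛ_
  _≈ₛ_ : Series → Series → Set ℓ₁
  f ≈ₛ g = ∀ n → f n ≈ g n

  oneₛ : Series
  oneₛ zero    = 1#
  oneₛ (suc _) = 0#

  tₛ : Series
  tₛ zero          = 0#
  tₛ (suc zero)    = 1#
  tₛ (suc (suc _)) = 0#

  infixl 7 _*ₛ_
  _*ₛ_ : Series → Series → Series
  (f *ₛ g) n = ∑[ k ≤ n ] (f (toℕ k) * g (n ∸ toℕ k))

  infixr 8 _^ₛ_
  _^ₛ_ : Series → ℕ → Series
  f ^ₛ zero  = oneₛ
  f ^ₛ suc n = f *ₛ (f ^ₛ n)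

  -- f(g(t)), meaningful only when g has zero constant term: then gʲ has no
  -- terms of degree below j, so stopping the sum at j = n loses nothing.

  infixr 9 _∘ₛ_
  _∘ₛ_ : Series → Series → Series
  (f ∘ₛ g) n = ∑[ j ≤ n ] (f (toℕ j) * (g ^ₛ toℕ j) n)

  -- Polynomials: coefficient lists, constant term first. Trailing zeros are
  -- allowed, so equality is equality of all coefficients.

  Poly : Set c
  Poly = List Carrier

  coeff : Poly → ℕ → Carrier
  coeff []      _       = 0#
  coeff (a ∷ p) zero    = a
  coeff (a ∷ p) (suc n) = coeff p n

  infix 4 _≈ₚ_
  _≈ₚ_ : Poly → Poly → Set ℓ₁
  p ≈ₚ q = ∀ n → coeff p n ≈ coeff q n

  infixl 6 _+ₚ_
  _+ₚ_ : Poly → Poly → Poly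
  []      +ₚ q       = q
  (a ∷ p) +ₚ []      = a ∷ p
  (a ∷ p) +ₚ (b ∷ q) = (a + b) ∷ (p +ₚ q)

  infixr 7 _*ₚ_
  _*ₚ_ : Carrier → Poly → Poly
  a *ₚ p = map (a *_) p

  monomial : ℕ → Poly
  monomial n = replicate n 0# ++ (1# ∷ [])

  eval : Poly → Carrier → Carrier
  eval []      x = 0#
  eval (a ∷ p) x = a + x * eval p x

  weightFrom : ℕ → Poly → Poly
  weightFrom n []      = []
  weightFrom n (a ∷ p) = (n · a) ∷ weightFrom (suc n) p

  D : Poly → Poly
  D []      = []
  D (_ ∷ p) = weightFrom 1 p

  -- f(D) p = Σ_ν f_ν Dᵛ p. The sum is finite: each D shortens a nonempty list
  -- by one, so Dᵛ p is [] from ν = length p on.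

  infix 10 _⟨D⟩
  _⟨D⟩ : Series → Poly → Poly
  (f ⟨D⟩) p = foldr _+ₚ_ [] (applyUpTo (λ ν → f ν *ₚ iterate D p ν) (length p))

  record IsDelta (φ : Series) : Set ℓ₁ where
    field
      φ₀≈0 : φ 0 ≈ 0#
      φ₁≈1 : φ 1 ≈ 1#

  record IsCompositionalInverse (φ φ⁻¹ : Series) : Set ℓ₁ where
    field
      φ⁻¹₀≈0   : φ⁻¹ 0 ≈ 0#
      inverseʳ : φ ∘ₛ φ⁻¹ ≈ₛ tₛ
      inverseˡ : φ⁻¹ ∘ₛ φ ≈ₛ tₛ

  record IsPoweroids (φ : Series) (pow : ℕ → Poly) : Set ℓ₁ where
    field
      pow-zero : pow 0 ≈ₚ 1# ∷ []
      lowering : ∀ n → (φ ⟨D⟩) (pow (suc n)) ≈ₚ (suc n · 1#) *ₚ pow n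
      at-zero  : ∀ n → eval (pow (suc n)) 0# ≈ 0#

  -- f(η)0ⁿ = (f(φ⁻¹(D_z)) zⁿ)|_{z=0}

  umbral : (φ⁻¹ f : Series) → ℕ → Carrier
  umbral φ⁻¹ f n = eval (((f ∘ₛ φ⁻¹) ⟨D⟩) (monomial n)) 0#

  -- Σ aₙ tⁿ/n!

  egf : (ℕ → Carrier) → Series
  egf a n = a n * 1/ n !

  -- e^{xη} as a series in η, with x a scalar parameter

  exp : Carrier → Series
  exp x = egf (x ^_)

  -- e^{xη} e^{0·t}, as a series in t

  e : (φ⁻¹ : Series) → Carrier → Series
  e φ⁻¹ x = egf (umbral φ⁻¹ (exp x))

{-# OPTIONS --safe #-}

-- Pair a series f with a polynomial p by ⟨f , p⟩ = (f(D) p)(0) = Σ fₖ k! pₖ, so that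
-- multiplication by φ is adjoint to φ(D). Lowering the poweroid n times gives
-- ⟨f ∘ φ , x^{n}⟩ = n! fₙ for every f. For f = e^{xt} ∘ φ⁻¹ the left side becomes
-- ⟨e^{xt} , z^{n}⟩ = x^{n}, so x^{n}/n! is the n-th coefficient of e^{x φ⁻¹(t)}. The product
-- rule is e^{xt} e^{yt} = e^{(x+y)t} composed with φ⁻¹.

module Submission where

open import Defs
open import Algebra.Apartness.Bundles using (HeytingField)
open import Algebra.Bundles using (CommutativeRing)
import Algebra.Properties.CommutativeSemiring.Binomial as Binomial
import Algebra.Properties.Ring as RingProperties
import Algebra.Properties.Semiring.Mult as Mult
import Algebra.Properties.Semiring.Sum as Sum
import Algebra.Solver.Ring.NaturalCoefficients.Default as Solver
open import Data.Fin.Base using (Fin; toℕ)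
open import Data.Fin.Properties using (toℕ≤pred[n])
open import Data.List.Base using ([]; _∷_; length; foldr; applyUpTo)
open import Data.Nat.Base as ℕ using (ℕ; zero; suc; _∸_; _!; _≤_; _<_; z≤n; s≤s)
open import Data.Nat.Combinatorics using (_C_; nCk≡n!/k![n-k]!; k![n∸k]!∣n!)
open import Data.Nat.DivMod using (m/n*n≡m)
open import Data.Nat.GeneralisedArithmetic using (iterate)
import Data.Nat.Properties as ℕₚ
open import Data.Product.Base using (_×_; _,_; proj₂)
open import Function.Base using (_∘_)
open import Relation.Binary.PropositionalEquality.Core as ≡ using (_≡_)
import Relation.Binary.Reasoning.Setoid as SetoidReasoning

-- The factorial formula for `n C k` is a truncating quotient; it is exact because
-- `k ! ℕ.* (n ∸ k) !` divides `n !`.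
nCk*[k!*[n∸k]!]≡n! : ∀ {n k} → k ≤ n → (n C k) ℕ.* (k ! ℕ.* (n ∸ k) !) ≡ n !
nCk*[k!*[n∸k]!]≡n! {n} {k} k≤n =
  ≡.trans (≡.cong (ℕ._* (k ! ℕ.* (n ∸ k) !)) (nCk≡n!/k![n-k]! k≤n))
          (m/n*n≡m (k![n∸k]!∣n! k≤n))
  where instance _ = k ℕₚ.!* (n ∸ k) !≢0

module Umbral {c ℓ₁ ℓ₂} (K : HeytingField c ℓ₁ ℓ₂) (char0 : CharacteristicZero K) where
  open Poweroids K char0
  open CommutativeRing commutativeRing
    using ( setoid; semiring; commutativeSemiring; refl; sym; trans; reflexive
          ; +-cong; +-congˡ; +-congʳ; +-identityˡ; +-identityʳ
          ; *-cong; *-congˡ; *-congʳ; *-identityˡ; *-identityʳ; *-assoc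
          ; distribˡ; distribʳ; zeroˡ; zeroʳ; _-_; ring )
  open Mult semiring
    using (×-congʳ; ×-congˡ; ×-assocˡ; ×-comm-*; ×-assoc-*; ×-homo-1)
  open Sum semiring
    using (sum; sum-cong-≋; ∑-distrib-+; *-distribˡ-sum)
  open RingProperties ring using (-0#≈0#)
  open Solver commutativeSemiring using (solve; _:=_; _:+_; _:*_; con)
  open SetoidReasoning setoid

  -- Natural multiples and factorials

  ·-as-* : ∀ n x → n · x ≈ (n · 1#) * x
  ·-as-* n x = sym (trans (×-assoc-* n 1# x) (×-congʳ n (*-identityˡ x)))

  ·-zeroʳ : ∀ n → n · 0# ≈ 0#
  ·-zeroʳ n = trans (·-as-* n 0#) (zeroʳ _)

  ·-distribˡ-+ : ∀ n x y → n · (x + y) ≈ n · x + n · y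
  ·-distribˡ-+ n x y = begin
    n · (x + y)                    ≈⟨ ·-as-* n _ ⟩
    (n · 1#) * (x + y)             ≈⟨ distribˡ _ _ _ ⟩
    (n · 1#) * x + (n · 1#) * y    ≈⟨ +-cong (·-as-* n x) (·-as-* n y) ⟨
    n · x + n · y                  ∎

  ·-distrib-* : ∀ m n x y → (m ℕ.* n) · (x * y) ≈ (m · x) * (n · y)
  ·-distrib-* m n x y = begin
    (m ℕ.* n) · (x * y)  ≈⟨ ×-assocˡ _ m n ⟨
    m · (n · (x * y))    ≈⟨ ×-congʳ m (×-comm-* n x y) ⟨
    m · (x * (n · y))    ≈⟨ ×-assoc-* m x _ ⟨
    (m · x) * (n · y)    ∎

  [1+n]·1/[1+n]≈1 : ∀ n → suc n · 1/[1+ n ] ≈ 1#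
  [1+n]·1/[1+n]≈1 n = begin
    suc n · 1/[1+ n ]              ≈⟨ ·-as-* (suc n) _ ⟩
    (suc n · 1#) * 1/[1+ n ]       ≈⟨ *-congʳ (trans (+-congˡ -0#≈0#) (+-identityʳ _)) ⟨
    (suc n · 1# - 0#) * 1/[1+ n ]  ≈⟨ proj₂ (proj₂ (#⇒invertible (char0 n))) ⟩
    1#                             ∎

  n!·1/n!≈1 : ∀ n → (n !) · 1/ n ! ≈ 1#
  n!·1/n!≈1 zero    = ×-homo-1 1#
  n!·1/n!≈1 (suc n) = begin
    (suc n !) · (1/[1+ n ] * 1/ n !)         ≈⟨ ·-distrib-* (suc n) (n !) _ _ ⟩
    (suc n · 1/[1+ n ]) * ((n !) · 1/ n !)   ≈⟨ *-cong ([1+n]·1/[1+n]≈1 n) (n!·1/n!≈1 n) ⟩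
    1# * 1#                                  ≈⟨ *-identityˡ 1# ⟩
    1#                                       ∎

  n!·[x/n!]≈x : ∀ n x → (n !) · (x * 1/ n !) ≈ x
  n!·[x/n!]≈x n x = begin
    (n !) · (x * 1/ n !)   ≈⟨ ×-comm-* (n !) x _ ⟨
    x * ((n !) · 1/ n !)   ≈⟨ *-congˡ (n!·1/n!≈1 n) ⟩
    x * 1#                 ≈⟨ *-identityʳ x ⟩
    x                      ∎

  [n!·x]/n!≈x : ∀ n x → ((n !) · x) * 1/ n ! ≈ x
  [n!·x]/n!≈x n x = trans (×-assoc-* (n !) x _) (n!·[x/n!]≈x n x)

  -- Products of exponential generating functions

  -- In the `k`-th term, `n !` splits as `n C k` times `k !` times `(n ∸ k) !`, and the last two
  -- cancel the denominators of the two factors.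
  n!·egf-*ₛ : ∀ a b n →
    (n !) · (egf a *ₛ egf b) n ≈ ∑[ k ≤ n ] ((n C toℕ k) · (a (toℕ k) * b (n ∸ toℕ k)))
  n!·egf-*ₛ a b n = begin
    (n !) · (egf a *ₛ egf b) n           ≈⟨ ·-as-* (n !) _ ⟩
    ((n !) · 1#) * (egf a *ₛ egf b) n    ≈⟨ *-distribˡ-sum {suc n} _ (λ k → egf a (toℕ k) * egf b (n ∸ toℕ k)) ⟩
    ∑[ k ≤ n ] (((n !) · 1#) * (egf a (toℕ k) * egf b (n ∸ toℕ k)))
                                         ≈⟨ sum-cong-≋ {suc n} (λ k → term (toℕ k) (toℕ≤pred[n] k)) ⟩
    ∑[ k ≤ n ] ((n C toℕ k) · (a (toℕ k) * b (n ∸ toℕ k))) ∎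
    where
    term : ∀ k → k ≤ n →
      ((n !) · 1#) * (egf a k * egf b (n ∸ k)) ≈ (n C k) · (a k * b (n ∸ k))
    term k k≤n = begin
      ((n !) · 1#) * (egf a k * egf b (n ∸ k))
        ≈⟨ ·-as-* (n !) _ ⟨
      (n !) · (egf a k * egf b (n ∸ k))
        ≈⟨ ×-congˡ (nCk*[k!*[n∸k]!]≡n! k≤n) ⟨
      ((n C k) ℕ.* (k ! ℕ.* (n ∸ k) !)) · (egf a k * egf b (n ∸ k))
        ≈⟨ ×-assocˡ _ (n C k) _ ⟨
      (n C k) · ((k ! ℕ.* (n ∸ k) !) · (egf a k * egf b (n ∸ k)))
        ≈⟨ ×-congʳ (n C k) (·-distrib-* (k !) ((n ∸ k) !) _ _) ⟩
      (n C k) · (((k !) · egf a k) * (((n ∸ k) !) · egf b (n ∸ k)))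
        ≈⟨ ×-congʳ (n C k) (*-cong (n!·[x/n!]≈x k _) (n!·[x/n!]≈x (n ∸ k) _)) ⟩
      (n C k) · (a k * b (n ∸ k)) ∎

  -- After multiplication by `n !` this is the binomial theorem for `(x + y) ^ n`.
  exp-*ₛ : ∀ x y → exp x *ₛ exp y ≈ₛ exp (x + y)
  exp-*ₛ x y n = begin
    (exp x *ₛ exp y) n                       ≈⟨ [n!·x]/n!≈x n _ ⟨
    ((n !) · (exp x *ₛ exp y) n) * 1/ n !    ≈⟨ *-congʳ (n!·egf-*ₛ (x ^_) (y ^_) n) ⟩
    (∑[ k ≤ n ] ((n C toℕ k) · (x ^ toℕ k * y ^ (n ∸ toℕ k)))) * 1/ n !
                                             ≈⟨ *-congʳ (sym (Binomial.theorem commutativeSemiring n x y)) ⟩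
    exp (x + y) n                            ∎

  [xy+z]w≈x[yw]+zw : ∀ x y z w → (x * y + z) * w ≈ x * (y * w) + z * w
  [xy+z]w≈x[yw]+zw x y z w = trans (distribʳ w (x * y) z) (+-congʳ (*-assoc x y w))

  w[xy+z]≈x[wy]+wz : ∀ x y z w → w * (x * y + z) ≈ x * (w * y) + w * z
  w[xy+z]≈x[wy]+wz =
    solve 4 (λ x y z w → w :* (x :* y :+ z) := x :* (w :* y) :+ w :* z) refl

  -- The shape `x * f + g` covers additivity and scaling at once; the Horner recursions below
  -- produce exactly this shape.
  sum-linear : ∀ {n} x (f g h : Fin n → Carrier) →
    (∀ i → h i ≈ x * f i + g i) → sum h ≈ x * sum f + sum g
  sum-linear x f g h h≈xf+g = begin
    sum h                               ≈⟨ sum-cong-≋ h≈xf+g ⟩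
    sum (λ i → x * f i + g i)           ≈⟨ ∑-distrib-+ (λ i → x * f i) g ⟩
    sum (λ i → x * f i) + sum g         ≈⟨ +-congʳ (*-distribˡ-sum x f) ⟨
    x * sum f + sum g                   ∎

  -- The ring of formal power series

  -- Coefficient `n` of a product sees `g` only up to degree `n`. The bounded hypothesis lets
  -- truncated sums, which agree only in low degrees, be exchanged.
  *ₛ-cong-≤ : ∀ f f′ g g′ n → f ≈ₛ f′ → (∀ m → m ≤ n → g m ≈ g′ m) →
              (f *ₛ g) n ≈ (f′ *ₛ g′) n
  *ₛ-cong-≤ f f′ g g′ n f≈f′ g≈g′ =
    sum-cong-≋ {suc n} (λ k → *-cong (f≈f′ (toℕ k)) (g≈g′ (n ∸ toℕ k) (ℕₚ.m∸n≤m n (toℕ k))))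

  *ₛ-distribʳ : ∀ x f f′ g n → ((λ m → x * f m + f′ m) *ₛ g) n ≈ x * (f *ₛ g) n + (f′ *ₛ g) n
  *ₛ-distribʳ x f f′ g n =
    sum-linear {suc n} x (λ k → f (toℕ k) * g (n ∸ toℕ k)) (λ k → f′ (toℕ k) * g (n ∸ toℕ k)) _
      (λ k → [xy+z]w≈x[yw]+zw x (f (toℕ k)) (f′ (toℕ k)) (g (n ∸ toℕ k)))

  *ₛ-distribˡ : ∀ x f g g′ n → (f *ₛ (λ m → x * g m + g′ m)) n ≈ x * (f *ₛ g) n + (f *ₛ g′) n
  *ₛ-distribˡ x f g g′ n =
    sum-linear {suc n} x (λ k → f (toℕ k) * g (n ∸ toℕ k)) (λ k → f (toℕ k) * g′ (n ∸ toℕ k)) _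
      (λ k → w[xy+z]≈x[wy]+wz x (g (n ∸ toℕ k)) (g′ (n ∸ toℕ k)) (f (toℕ k)))

  *ₛ-zeroʳ : ∀ f n → (f *ₛ (λ _ → 0#)) n ≈ 0#
  *ₛ-zeroʳ f zero    = trans (+-identityʳ _) (zeroʳ _)
  *ₛ-zeroʳ f (suc n) = trans (+-cong (zeroʳ _) (*ₛ-zeroʳ (f ∘ suc) n)) (+-identityˡ 0#)

  *ₛ-zeroˡ : ∀ f n → ((λ _ → 0#) *ₛ f) n ≈ 0#
  *ₛ-zeroˡ f zero    = trans (+-identityʳ _) (zeroˡ _)
  *ₛ-zeroˡ f (suc n) = trans (+-cong (zeroˡ _) (*ₛ-zeroˡ f n)) (+-identityˡ 0#)

  *ₛ-identityˡ : ∀ f → oneₛ *ₛ f ≈ₛ f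
  *ₛ-identityˡ f zero    = trans (+-identityʳ _) (*-identityˡ _)
  *ₛ-identityˡ f (suc n) = trans (+-cong (*-identityˡ _) (*ₛ-zeroˡ f n)) (+-identityʳ _)

  -- Induction on the degree, peeling off `f 0`: by definition `(f *ₛ g) (suc n)` is
  -- `f 0 * g (suc n) + (f ∘ suc *ₛ g) n`.
  *ₛ-assoc : ∀ f g h → f *ₛ (g *ₛ h) ≈ₛ (f *ₛ g) *ₛ h
  *ₛ-assoc f g h zero =
    solve 3 (λ f g h → f :* (g :* h :+ con 0) :+ con 0 := (f :* g :+ con 0) :* h :+ con 0) refl _ _ _
  *ₛ-assoc f g h (suc n) = begin
    f 0 * (g 0 * h (suc n) + (g ∘ suc *ₛ h) n) + ((f ∘ suc) *ₛ (g *ₛ h)) n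
      ≈⟨ +-congˡ (*ₛ-assoc (f ∘ suc) g h n) ⟩
    f 0 * (g 0 * h (suc n) + (g ∘ suc *ₛ h) n) + ((f ∘ suc *ₛ g) *ₛ h) n
      ≈⟨ solve 5 (λ f g h x y → f :* (g :* h :+ x) :+ y := (f :* g :+ con 0) :* h :+ (f :* x :+ y))
           refl _ _ _ _ _ ⟩
    (f 0 * g 0 + 0#) * h (suc n) + (f 0 * (g ∘ suc *ₛ h) n + ((f ∘ suc *ₛ g) *ₛ h) n)
      ≈⟨ +-congˡ (*ₛ-distribʳ (f 0) (g ∘ suc) (f ∘ suc *ₛ g) h n) ⟨
    ((f *ₛ g) *ₛ h) (suc n) ∎

  *ₛ-distribˡ-∑ : ∀ f N (w : ℕ → Carrier) (h : ℕ → Series) n →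
    (f *ₛ (λ m → ∑[ j < N ] (w (toℕ j) * h (toℕ j) m))) n ≈ ∑[ j < N ] (w (toℕ j) * (f *ₛ h (toℕ j)) n)
  *ₛ-distribˡ-∑ f zero    w h n = *ₛ-zeroʳ f n
  *ₛ-distribˡ-∑ f (suc N) w h n =
    trans (*ₛ-distribˡ (w 0) f (h 0) (λ m → ∑[ j < N ] (w (suc (toℕ j)) * h (suc (toℕ j)) m)) n)
          (+-congˡ (*ₛ-distribˡ-∑ f N (w ∘ suc) (h ∘ suc) n))

  -- Composition of series

  module _ (g : Series) (g₀≈0 : g 0 ≈ 0#) where

    g*ₛ-zero : ∀ h → (g *ₛ h) 0 ≈ 0#
    g*ₛ-zero h = trans (+-identityʳ _) (trans (*-congʳ g₀≈0) (zeroˡ _))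

    -- Since `g 0` vanishes, `g` is `t` times `g ∘ suc`. Hence degree `suc n` of the product
    -- involves `h` only up to degree `n`, which drives the inductions on degree below.
    g*ₛ-suc : ∀ h n → (g *ₛ h) (suc n) ≈ (g ∘ suc *ₛ h) n
    g*ₛ-suc h n = trans (+-congʳ (trans (*-congʳ g₀≈0) (zeroˡ _))) (+-identityˡ _)

    -- (f ∘ₛ g) n is truncated (suc n) f n; the bound moves with n, so the recursion on f
    -- below first needs independence of the bound.
    truncated : ℕ → Series → Series
    truncated N f n = ∑[ j < N ] (f (toℕ j) * (g ^ₛ toℕ j) n)

    -- Horner's scheme: every power of `g` after the zeroth contains a factor `g`, which is pulled
    -- out of the sum.
    truncated-suc : ∀ N f n →
      truncated (suc N) f n ≈ f 0 * oneₛ n + (g *ₛ truncated N (f ∘ suc)) n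
    truncated-suc N f n = +-congˡ (sym (*ₛ-distribˡ-∑ g N (f ∘ suc) (g ^ₛ_) n))

    -- Each factor `g` raises the degree by at least one, so after one Horner step the inner sums
    -- need to agree only up to degree `n`, with both bounds lowered by one.
    truncated-stable : ∀ M N f n → n < M → n < N → truncated M f n ≈ truncated N f n
    truncated-stable (suc M) (suc N) f zero _ _ = begin
      truncated (suc M) f 0                              ≈⟨ truncated-suc M f 0 ⟩
      f 0 * 1# + (g *ₛ T) 0                              ≈⟨ +-congˡ (trans (g*ₛ-zero T) (sym (g*ₛ-zero T′))) ⟩
      f 0 * 1# + (g *ₛ T′) 0                             ≈⟨ truncated-suc N f 0 ⟨
      truncated (suc N) f 0                              ∎
      where
      T  = truncated M (f ∘ suc)
      T′ = truncated N (f ∘ suc)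
    truncated-stable (suc M) (suc N) f (suc n) (s≤s n<M) (s≤s n<N) = begin
      truncated (suc M) f (suc n)
        ≈⟨ truncated-suc M f (suc n) ⟩
      f 0 * 0# + (g *ₛ T) (suc n)
        ≈⟨ +-congˡ (g*ₛ-suc T n) ⟩
      f 0 * 0# + (g ∘ suc *ₛ T) n
        ≈⟨ +-congˡ (*ₛ-cong-≤ (g ∘ suc) (g ∘ suc) T T′ n (λ _ → refl) λ m m≤n →
             truncated-stable M N (f ∘ suc) m (ℕₚ.≤-<-trans m≤n n<M) (ℕₚ.≤-<-trans m≤n n<N)) ⟩
      f 0 * 0# + (g ∘ suc *ₛ T′) n
        ≈⟨ +-congˡ (g*ₛ-suc T′ n) ⟨
      f 0 * 0# + (g *ₛ T′) (suc n)
        ≈⟨ truncated-suc N f (suc n) ⟨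
      truncated (suc N) f (suc n) ∎
      where
      T  = truncated M (f ∘ suc)
      T′ = truncated N (f ∘ suc)

    ∘ₛ-zero : ∀ f → (f ∘ₛ g) 0 ≈ f 0
    ∘ₛ-zero f = trans (+-identityʳ _) (*-identityʳ _)

    -- Horner's scheme for the composite itself, read in degree `suc n`. Stability replaces the
    -- fixed bound `suc n` by the bound `suc m` that the inner composite has in each degree `m`.
    ∘ₛ-suc : ∀ f n → (f ∘ₛ g) (suc n) ≈ (g ∘ suc *ₛ (f ∘ suc) ∘ₛ g) n
    ∘ₛ-suc f n = begin
      (f ∘ₛ g) (suc n)                   ≈⟨ truncated-suc (suc n) f (suc n) ⟩
      f 0 * 0# + (g *ₛ T) (suc n)        ≈⟨ +-cong (zeroʳ (f 0)) (g*ₛ-suc T n) ⟩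
      0# + (g ∘ suc *ₛ T) n              ≈⟨ +-identityˡ _ ⟩
      (g ∘ suc *ₛ T) n
        ≈⟨ *ₛ-cong-≤ (g ∘ suc) (g ∘ suc) T ((f ∘ suc) ∘ₛ g) n (λ _ → refl) (λ m m≤n →
             truncated-stable (suc n) (suc m) (f ∘ suc) m (s≤s m≤n) ℕₚ.≤-refl) ⟩
      (g ∘ suc *ₛ (f ∘ suc) ∘ₛ g) n      ∎
      where
      T = truncated (suc n) (f ∘ suc)

    ∘ₛ-horner : ∀ f n → (f ∘ₛ g) n ≈ f 0 * oneₛ n + (g *ₛ (f ∘ suc) ∘ₛ g) n
    ∘ₛ-horner f zero = begin
      (f ∘ₛ g) 0                         ≈⟨ ∘ₛ-zero f ⟩
      f 0                                ≈⟨ *-identityʳ _ ⟨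
      f 0 * 1#                           ≈⟨ +-identityʳ _ ⟨
      f 0 * 1# + 0#                      ≈⟨ +-congˡ (g*ₛ-zero f′∘g) ⟨
      f 0 * 1# + (g *ₛ f′∘g) 0           ∎
      where f′∘g = (f ∘ suc) ∘ₛ g
    ∘ₛ-horner f (suc n) = begin
      (f ∘ₛ g) (suc n)                   ≈⟨ ∘ₛ-suc f n ⟩
      (g ∘ suc *ₛ f′∘g) n                ≈⟨ g*ₛ-suc f′∘g n ⟨
      (g *ₛ f′∘g) (suc n)                ≈⟨ +-identityˡ _ ⟨
      0# + (g *ₛ f′∘g) (suc n)           ≈⟨ +-congʳ (zeroʳ (f 0)) ⟨
      f 0 * 0# + (g *ₛ f′∘g) (suc n)     ∎
      where f′∘g = (f ∘ suc) ∘ₛ g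

    ∘ₛ-congˡ : ∀ f f′ → f ≈ₛ f′ → f ∘ₛ g ≈ₛ f′ ∘ₛ g
    ∘ₛ-congˡ f f′ f≈f′ n = sum-cong-≋ {suc n} (λ j → *-congʳ {(g ^ₛ toℕ j) n} (f≈f′ (toℕ j)))

    ∘ₛ-distrib : ∀ x f f′ n → ((λ m → x * f m + f′ m) ∘ₛ g) n ≈ x * (f ∘ₛ g) n + (f′ ∘ₛ g) n
    ∘ₛ-distrib x f f′ n =
      sum-linear {suc n} x (λ j → f (toℕ j) * (g ^ₛ toℕ j) n) (λ j → f′ (toℕ j) * (g ^ₛ toℕ j) n) _
        (λ j → [xy+z]w≈x[yw]+zw x (f (toℕ j)) (f′ (toℕ j)) ((g ^ₛ toℕ j) n))

    -- Shifting `f *ₛ h` by one degree gives `f 0` times the shift of `h`, plus `(f ∘ suc) *ₛ h`;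
    -- induction applies to the second summand. It is needed in all degrees `m ≤ n`, so the
    -- recursion runs on the bound `N`.
    ∘ₛ-*ₛ-≤ : ∀ N f h n → n ≤ N → ((f *ₛ h) ∘ₛ g) n ≈ ((f ∘ₛ g) *ₛ (h ∘ₛ g)) n
    ∘ₛ-*ₛ-≤ N f h zero _ = begin
      ((f *ₛ h) ∘ₛ g) 0                ≈⟨ ∘ₛ-zero (f *ₛ h) ⟩
      f 0 * h 0 + 0#                   ≈⟨ +-congʳ (*-cong (∘ₛ-zero f) (∘ₛ-zero h)) ⟨
      ((f ∘ₛ g) *ₛ (h ∘ₛ g)) 0         ∎
    ∘ₛ-*ₛ-≤ (suc N) f h (suc n) (s≤s n≤N) = begin
      ((f *ₛ h) ∘ₛ g) (suc n)
        ≈⟨ ∘ₛ-suc (f *ₛ h) n ⟩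
      (g′ *ₛ ((f *ₛ h) ∘ suc) ∘ₛ g) n
        ≈⟨ *ₛ-cong-≤ g′ g′ (((f *ₛ h) ∘ suc) ∘ₛ g) (λ m → f 0 * h′∘g m + f′h∘g m) n (λ _ → refl)
             (λ m m≤n → trans (∘ₛ-distrib (f 0) (h ∘ suc) (f ∘ suc *ₛ h) m)
                              (+-congˡ (∘ₛ-*ₛ-≤ N (f ∘ suc) h m (ℕₚ.≤-trans m≤n n≤N)))) ⟩
      (g′ *ₛ (λ m → f 0 * h′∘g m + f′h∘g m)) n
        ≈⟨ *ₛ-distribˡ (f 0) g′ h′∘g f′h∘g n ⟩
      f 0 * (g′ *ₛ h′∘g) n + (g′ *ₛ (f′∘g *ₛ (h ∘ₛ g))) n
        ≈⟨ +-cong (*-cong (sym (∘ₛ-zero f)) (sym (∘ₛ-suc h n))) (*ₛ-assoc g′ f′∘g (h ∘ₛ g) n) ⟩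
      (f ∘ₛ g) 0 * (h ∘ₛ g) (suc n) + ((g′ *ₛ f′∘g) *ₛ (h ∘ₛ g)) n
        ≈⟨ +-congˡ (*ₛ-cong-≤ (g′ *ₛ f′∘g) ((f ∘ₛ g) ∘ suc) (h ∘ₛ g) (h ∘ₛ g) n
             (λ m → sym (∘ₛ-suc f m)) (λ _ _ → refl)) ⟩
      ((f ∘ₛ g) *ₛ (h ∘ₛ g)) (suc n) ∎
      where
      g′    = g ∘ suc
      f′∘g  = (f ∘ suc) ∘ₛ g
      h′∘g  = (h ∘ suc) ∘ₛ g
      f′h∘g = f′∘g *ₛ (h ∘ₛ g)

    ∘ₛ-*ₛ : ∀ f h → (f *ₛ h) ∘ₛ g ≈ₛ (f ∘ₛ g) *ₛ (h ∘ₛ g)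
    ∘ₛ-*ₛ f h n = ∘ₛ-*ₛ-≤ n f h n ℕₚ.≤-refl

  -- Applying `∘ₛ-suc` to both compositions and using multiplicativity brings out the factor
  -- `φ′ *ₛ ψ′ ∘ₛ φ`. This is the shift of `ψ ∘ₛ φ`, hence of `tₛ`, so it equals `oneₛ`, and the
  -- same claim for `f ∘ suc` in degree `n` remains.
  ∘ₛ-cancel : ∀ φ ψ → φ 0 ≈ 0# → ψ 0 ≈ 0# → ψ ∘ₛ φ ≈ₛ tₛ → ∀ f → (f ∘ₛ ψ) ∘ₛ φ ≈ₛ f
  ∘ₛ-cancel φ ψ φ₀≈0 ψ₀≈0 ψ∘φ≈t f zero = trans (∘ₛ-zero φ φ₀≈0 (f ∘ₛ ψ)) (∘ₛ-zero ψ ψ₀≈0 f)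
  ∘ₛ-cancel φ ψ φ₀≈0 ψ₀≈0 ψ∘φ≈t f (suc n) = begin
    ((f ∘ₛ ψ) ∘ₛ φ) (suc n)
      ≈⟨ ∘ₛ-suc φ φ₀≈0 (f ∘ₛ ψ) n ⟩
    (φ′ *ₛ ((f ∘ₛ ψ) ∘ suc) ∘ₛ φ) n
      ≈⟨ *ₛ-cong-≤ φ′ φ′ (((f ∘ₛ ψ) ∘ suc) ∘ₛ φ) ((ψ′ ∘ₛ φ) *ₛ h) n (λ _ → refl) (λ m _ →
           trans (∘ₛ-congˡ φ φ₀≈0 ((f ∘ₛ ψ) ∘ suc) (ψ′ *ₛ f′ ∘ₛ ψ) (∘ₛ-suc ψ ψ₀≈0 f) m)
                 (∘ₛ-*ₛ φ φ₀≈0 ψ′ (f′ ∘ₛ ψ) m)) ⟩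
    (φ′ *ₛ ((ψ′ ∘ₛ φ) *ₛ h)) n
      ≈⟨ *ₛ-assoc φ′ (ψ′ ∘ₛ φ) h n ⟩
    ((φ′ *ₛ ψ′ ∘ₛ φ) *ₛ h) n
      ≈⟨ *ₛ-cong-≤ (φ′ *ₛ ψ′ ∘ₛ φ) oneₛ h h n φ′*[ψ′∘φ]≈1 (λ m _ → refl) ⟩
    (oneₛ *ₛ h) n
      ≈⟨ *ₛ-identityˡ h n ⟩
    h n
      ≈⟨ ∘ₛ-cancel φ ψ φ₀≈0 ψ₀≈0 ψ∘φ≈t f′ n ⟩
    f (suc n) ∎
    where
    φ′ = φ ∘ suc
    ψ′ = ψ ∘ suc
    f′ = f ∘ suc
    h  = (f′ ∘ₛ ψ) ∘ₛ φ
    tₛ∘suc≈oneₛ : tₛ ∘ suc ≈ₛ oneₛ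
    tₛ∘suc≈oneₛ zero    = refl
    tₛ∘suc≈oneₛ (suc _) = refl
    φ′*[ψ′∘φ]≈1 : φ′ *ₛ ψ′ ∘ₛ φ ≈ₛ oneₛ
    φ′*[ψ′∘φ]≈1 m =
      trans (sym (∘ₛ-suc φ φ₀≈0 ψ m)) (trans (ψ∘φ≈t (suc m)) (tₛ∘suc≈oneₛ m))

  -- The pairing of series with finitely supported sequences

  SupportedBelow : ℕ → (ℕ → Carrier) → Set ℓ₁
  SupportedBelow N a = ∀ k → N ≤ k → a k ≈ 0#

  pair : ℕ → Series → (ℕ → Carrier) → Carrier
  pair N f a = ∑[ k < N ] (f (toℕ k) * a (toℕ k))

  pair-cong : ∀ N f g a b → f ≈ₛ g → (∀ k → a k ≈ b k) → pair N f a ≈ pair N g b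
  pair-cong N f g a b f≈g a≈b = sum-cong-≋ {N} (λ k → *-cong (f≈g (toℕ k)) (a≈b (toℕ k)))

  pair-zeroʳ : ∀ N f a → SupportedBelow 0 a → pair N f a ≈ 0#
  pair-zeroʳ zero    f a a≈0 = refl
  pair-zeroʳ (suc N) f a a≈0 =
    trans (+-cong (trans (*-congˡ (a≈0 0 z≤n)) (zeroʳ _))
                  (pair-zeroʳ N (f ∘ suc) (a ∘ suc) (λ k _ → a≈0 (suc k) z≤n)))
          (+-identityˡ 0#)

  pair-zeroˡ : ∀ N a → pair N (λ _ → 0#) a ≈ 0#
  pair-zeroˡ zero    a = refl
  pair-zeroˡ (suc N) a = trans (+-cong (zeroˡ _) (pair-zeroˡ N (a ∘ suc))) (+-identityˡ 0#)

  -- The terms between the two bounds vanish. This makes pairings comparable when coefficient lists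
  -- have different lengths.
  pair-supported : ∀ M N f a → SupportedBelow M a → SupportedBelow N a → pair M f a ≈ pair N f a
  pair-supported zero    N       f a a<M _   = sym (pair-zeroʳ N f a a<M)
  pair-supported (suc M) zero    f a _   a<N = pair-zeroʳ (suc M) f a a<N
  pair-supported (suc M) (suc N) f a a<M a<N =
    +-congˡ (pair-supported M N (f ∘ suc) (a ∘ suc)
      (λ k M≤k → a<M (suc k) (s≤s M≤k)) (λ k N≤k → a<N (suc k) (s≤s N≤k)))

  pair-distribʳ : ∀ N x f g a → pair N (λ m → x * f m + g m) a ≈ x * pair N f a + pair N g a
  pair-distribʳ N x f g a =
    sum-linear {N} x (λ k → f (toℕ k) * a (toℕ k)) (λ k → g (toℕ k) * a (toℕ k)) _
      (λ k → [xy+z]w≈x[yw]+zw x (f (toℕ k)) (g (toℕ k)) (a (toℕ k)))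

  pair-distribˡ : ∀ N x f a b → pair N f (λ m → x * a m + b m) ≈ x * pair N f a + pair N f b
  pair-distribˡ N x f a b =
    sum-linear {N} x (λ k → f (toℕ k) * a (toℕ k)) (λ k → f (toℕ k) * b (toℕ k)) _
      (λ k → w[xy+z]≈x[wy]+wz x (a (toℕ k)) (b (toℕ k)) (f (toℕ k)))

  -- Multiplication by `f` is adjoint to the operator that applies `f` to the shift of sequences.
  -- The induction splits off `f 0`, which contributes `f 0` times the unshifted sequence.
  pair-*ₛ : ∀ N f g a → SupportedBelow N a →
    pair N (f *ₛ g) a ≈ pair N g (λ m → pair N f (λ k → a (k ℕ.+ m)))
  pair-*ₛ zero    f g a a<N = refl
  pair-*ₛ (suc N) f g a a<N = begin
    (f 0 * g 0 + 0#) * a 0 + pair N (λ m → f 0 * g (suc m) + (f′ *ₛ g) m) a′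
      ≈⟨ +-congˡ (pair-distribʳ N (f 0) (g ∘ suc) (f′ *ₛ g) a′) ⟩
    (f 0 * g 0 + 0#) * a 0 + (f 0 * pair N (g ∘ suc) a′ + pair N (f′ *ₛ g) a′)
      ≈⟨ solve 5 (λ f g a x y → (f :* g :+ con 0) :* a :+ (f :* x :+ y) := f :* (g :* a :+ x) :+ y)
           refl _ _ _ _ _ ⟩
    f 0 * pair (suc N) g a + pair N (f′ *ₛ g) a′
      ≈⟨ +-congˡ (pair-*ₛ N f′ g a′ (λ k N≤k → a<N (suc k) (s≤s N≤k))) ⟩
    f 0 * pair (suc N) g a + pair N g f′⟨a⟩
      -- The induction hypothesis has bound `N` while the goal has `suc N`; `f′⟨a⟩` already vanishes
      -- from `N` on, because it reads `a` only past a shift of at least one.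
      ≈⟨ +-congˡ (pair-supported N (suc N) g f′⟨a⟩ f′⟨a⟩<N (λ k N<k → f′⟨a⟩<N k (ℕₚ.<⇒≤ N<k))) ⟩
    f 0 * pair (suc N) g a + pair (suc N) g f′⟨a⟩
      ≈⟨ pair-distribˡ (suc N) (f 0) g a f′⟨a⟩ ⟨
    pair (suc N) g (λ m → pair (suc N) f (λ k → a (k ℕ.+ m))) ∎
    where
    f′ = f ∘ suc
    a′ = a ∘ suc
    f′⟨a⟩ : ℕ → Carrier
    f′⟨a⟩ m = pair N f′ (λ k → a (suc k ℕ.+ m))
    f′⟨a⟩<N : SupportedBelow N f′⟨a⟩
    f′⟨a⟩<N m N≤m = pair-zeroʳ N f′ (λ k → a (suc k ℕ.+ m))
      (λ k _ → a<N (suc k ℕ.+ m) (s≤s (ℕₚ.≤-trans N≤m (ℕₚ.m≤n+m m k))))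

  -- Polynomials

  coeff-supported : ∀ p → SupportedBelow (length p) (coeff p)
  coeff-supported []      k       _         = refl
  coeff-supported (a ∷ p) (suc k) (s≤s p≤k) = coeff-supported p k p≤k

  coeff-+ₚ : ∀ p q n → coeff (p +ₚ q) n ≈ coeff p n + coeff q n
  coeff-+ₚ []      q       n       = sym (+-identityˡ _)
  coeff-+ₚ (a ∷ p) []      n       = sym (+-identityʳ _)
  coeff-+ₚ (a ∷ p) (b ∷ q) zero    = refl
  coeff-+ₚ (a ∷ p) (b ∷ q) (suc n) = coeff-+ₚ p q n

  coeff-*ₚ : ∀ x p n → coeff (x *ₚ p) n ≈ x * coeff p n
  coeff-*ₚ x []      n       = sym (zeroʳ x)
  coeff-*ₚ x (a ∷ p) zero    = refl
  coeff-*ₚ x (a ∷ p) (suc n) = coeff-*ₚ x p n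

  coeff-weightFrom : ∀ j p n → coeff (weightFrom j p) n ≈ (n ℕ.+ j) · coeff p n
  coeff-weightFrom j []      n       = sym (·-zeroʳ (n ℕ.+ j))
  coeff-weightFrom j (a ∷ p) zero    = refl
  coeff-weightFrom j (a ∷ p) (suc n) =
    trans (coeff-weightFrom (suc j) p n) (×-congˡ (ℕₚ.+-suc n j))

  coeff-D : ∀ p n → coeff (D p) n ≈ suc n · coeff p (suc n)
  coeff-D []      n = sym (·-zeroʳ (suc n))
  coeff-D (a ∷ p) n = trans (coeff-weightFrom 1 p n) (×-congˡ (ℕₚ.+-comm n 1))

  eval-zero : ∀ p → eval p 0# ≈ coeff p 0
  eval-zero []      = refl
  eval-zero (a ∷ p) = trans (+-congˡ (zeroˡ _)) (+-identityʳ a)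

  eval-as-pair : ∀ p x → eval p x ≈ pair (length p) (x ^_) (coeff p)
  eval-as-pair []      x = refl
  eval-as-pair (a ∷ p) x = +-cong (sym (*-identityˡ a)) (begin
    x * eval p x                                                   ≈⟨ *-congˡ (eval-as-pair p x) ⟩
    x * pair (length p) (x ^_) (coeff p)                           ≈⟨ *-distribˡ-sum {length p} x _ ⟩
    ∑[ k < length p ] (x * (x ^ toℕ k * coeff p (toℕ k)))          ≈⟨ sum-cong-≋ {length p} (λ k → sym (*-assoc x _ _)) ⟩
    pair (length p) (λ k → x ^ suc k) (coeff p)                    ∎)

  -- Derivatives at zero, `(Dⁿ p)(0)`, and the action of `f ⟨D⟩` on them

  taylor : Poly → ℕ → Carrier
  taylor p n = (n !) · coeff p n

  taylor-supported : ∀ p → SupportedBelow (length p) (taylor p)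
  taylor-supported p k p≤k = trans (×-congʳ (k !) (coeff-supported p k p≤k)) (·-zeroʳ (k !))

  taylor-*ₚ : ∀ x p n → taylor (x *ₚ p) n ≈ x * taylor p n
  taylor-*ₚ x p n = trans (×-congʳ (n !) (coeff-*ₚ x p n)) (sym (×-comm-* (n !) x _))

  taylor-D : ∀ p n → taylor (D p) n ≈ taylor p (suc n)
  taylor-D p n = begin
    (n !) · coeff (D p) n                    ≈⟨ ×-congʳ (n !) (coeff-D p n) ⟩
    (n !) · (suc n · coeff p (suc n))        ≈⟨ ×-assocˡ _ (n !) (suc n) ⟩
    (n ! ℕ.* suc n) · coeff p (suc n)        ≈⟨ ×-congˡ (ℕₚ.*-comm (n !) (suc n)) ⟩
    (suc n !) · coeff p (suc n)              ∎

  -- Since `D` shifts Taylor sequences by one, entry `m` of the `k`-th derivative of `p` is entry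
  -- `k ℕ.+ m` of `p`.
  taylor-⟨D⟩ : ∀ f p m → taylor ((f ⟨D⟩) p) m ≈ pair (length p) f (λ k → taylor p (k ℕ.+ m))
  -- The number of summands is decoupled from the polynomial, as the recursion replaces `p` by
  -- `D p`.
  taylor-⟨D⟩ f p m = go (length p) f p
    where
    go : ∀ N f p → taylor (foldr _+ₚ_ [] (applyUpTo (λ ν → f ν *ₚ iterate D p ν) N)) m
                   ≈ pair N f (λ k → taylor p (k ℕ.+ m))
    go zero    f p = ·-zeroʳ (m !)
    go (suc N) f p = begin
      taylor (f 0 *ₚ p +ₚ rest) m                ≈⟨ ×-congʳ (m !) (coeff-+ₚ (f 0 *ₚ p) rest m) ⟩
      (m !) · (coeff (f 0 *ₚ p) m + coeff rest m) ≈⟨ ·-distribˡ-+ (m !) _ _ ⟩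
      taylor (f 0 *ₚ p) m + taylor rest m        ≈⟨ +-cong (taylor-*ₚ (f 0) p m) (go N (f ∘ suc) (D p)) ⟩
      f 0 * taylor p m + pair N (f ∘ suc) (λ k → taylor (D p) (k ℕ.+ m))
        ≈⟨ +-congˡ (pair-cong N (f ∘ suc) (f ∘ suc)
             (λ k → taylor (D p) (k ℕ.+ m)) (λ k → taylor p (suc k ℕ.+ m)) (λ _ → refl)
             (λ k → taylor-D p (k ℕ.+ m))) ⟩
      pair (suc N) f (λ k → taylor p (k ℕ.+ m))  ∎
      where
      rest = foldr _+ₚ_ [] (applyUpTo (λ ν → f (suc ν) *ₚ iterate D (D p) ν) N)

  pair-taylor : ∀ N f p → pair N f (taylor p) ≈ pair N (λ k → (k !) · f k) (coeff p)
  pair-taylor N f p = sum-cong-≋ {N} (λ k →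
    trans (×-comm-* (toℕ k !) (f (toℕ k)) (coeff p (toℕ k)))
          (sym (×-assoc-* (toℕ k !) (f (toℕ k)) (coeff p (toℕ k)))))

  -- The pairing of series with polynomials

  ⟨_,_⟩ : Series → Poly → Carrier
  ⟨ f , p ⟩ = pair (length p) f (taylor p)

  ⟨,⟩-congˡ : ∀ f g p → f ≈ₛ g → ⟨ f , p ⟩ ≈ ⟨ g , p ⟩
  ⟨,⟩-congˡ f g p f≈g = pair-cong (length p) f g (taylor p) (taylor p) f≈g (λ _ → refl)

  -- Frees the pairing from the list length of `p`, which trailing zeros can change without changing
  -- the polynomial.
  ⟨,⟩-as-pair : ∀ f p N a → (∀ n → taylor p n ≈ a n) → SupportedBelow N a → ⟨ f , p ⟩ ≈ pair N f a
  ⟨,⟩-as-pair f p N a p≈a a<N =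
    trans (pair-supported (length p) N f (taylor p)
             (taylor-supported p) (λ k N≤k → trans (p≈a k) (a<N k N≤k)))
          (pair-cong N f f (taylor p) a (λ _ → refl) p≈a)

  ⟨,⟩-congʳ : ∀ f p q → p ≈ₚ q → ⟨ f , p ⟩ ≈ ⟨ f , q ⟩
  ⟨,⟩-congʳ f p q p≈q =
    ⟨,⟩-as-pair f p (length q) (taylor q) (λ n → ×-congʳ (n !) (p≈q n)) (taylor-supported q)

  ⟨,⟩-*ₚ : ∀ f x p → ⟨ f , x *ₚ p ⟩ ≈ x * ⟨ f , p ⟩
  ⟨,⟩-*ₚ f x p = begin
    ⟨ f , x *ₚ p ⟩
      ≈⟨ ⟨,⟩-as-pair f (x *ₚ p) (length p) (λ n → x * taylor p n) (taylor-*ₚ x p)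
           (λ k p≤k → trans (*-congˡ (taylor-supported p k p≤k)) (zeroʳ x)) ⟩
    pair (length p) f (λ n → x * taylor p n)
      ≈⟨ sum-cong-≋ {length p} (λ k →
           solve 3 (λ f x a → f :* (x :* a) := x :* (f :* a)) refl (f (toℕ k)) x (taylor p (toℕ k))) ⟩
    ∑[ k < length p ] (x * (f (toℕ k) * taylor p (toℕ k)))
      ≈⟨ *-distribˡ-sum {length p} x (λ k → f (toℕ k) * taylor p (toℕ k)) ⟨
    x * ⟨ f , p ⟩ ∎

  -- The sequence that `pair-*ₛ` puts on the right is, by `taylor-⟨D⟩`, the Taylor sequence of
  -- `(f ⟨D⟩) p`.
  ⟨,⟩-adjoint : ∀ f g p → ⟨ f *ₛ g , p ⟩ ≈ ⟨ g , (f ⟨D⟩) p ⟩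
  ⟨,⟩-adjoint f g p =
    trans (pair-*ₛ (length p) f g (taylor p) (taylor-supported p))
          (sym (⟨,⟩-as-pair g ((f ⟨D⟩) p) (length p) f⟨p⟩ (taylor-⟨D⟩ f p) λ m p≤m →
            pair-zeroʳ (length p) f (λ k → taylor p (k ℕ.+ m)) λ k _ →
              taylor-supported p (k ℕ.+ m) (ℕₚ.≤-trans p≤m (ℕₚ.m≤n+m m k))))
    where
    f⟨p⟩ : ℕ → Carrier
    f⟨p⟩ m = pair (length p) f (λ k → taylor p (k ℕ.+ m))

  [f⟨D⟩p]₀≈⟨f,p⟩ : ∀ f p → eval ((f ⟨D⟩) p) 0# ≈ ⟨ f , p ⟩
  [f⟨D⟩p]₀≈⟨f,p⟩ f p = begin
    eval ((f ⟨D⟩) p) 0#                                ≈⟨ eval-zero ((f ⟨D⟩) p) ⟩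
    coeff ((f ⟨D⟩) p) 0                                ≈⟨ ×-homo-1 _ ⟨
    taylor ((f ⟨D⟩) p) 0                               ≈⟨ taylor-⟨D⟩ f p 0 ⟩
    pair (length p) f (λ k → taylor p (k ℕ.+ 0))
      ≈⟨ pair-cong (length p) f f (λ k → taylor p (k ℕ.+ 0)) (taylor p) (λ _ → refl)
           (λ k → reflexive (≡.cong (taylor p) (ℕₚ.+-identityʳ k))) ⟩
    ⟨ f , p ⟩                                          ∎

  ⟨1,p⟩≈p₀ : ∀ p → ⟨ oneₛ , p ⟩ ≈ coeff p 0
  ⟨1,p⟩≈p₀ []      = refl
  ⟨1,p⟩≈p₀ (a ∷ p) = begin
    1# * (1 · a) + pair (length p) (λ _ → 0#) (taylor (a ∷ p) ∘ suc)
      ≈⟨ +-cong (trans (*-identityˡ _) (×-homo-1 a))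
                (pair-zeroˡ (length p) (taylor (a ∷ p) ∘ suc)) ⟩
    a + 0#   ≈⟨ +-identityʳ a ⟩
    a        ∎

  -- The factorials in the Taylor sequence cancel the denominators of `exp x`, leaving the powers of
  -- `x` against the coefficients of `p`.
  ⟨exp,p⟩≈eval : ∀ x p → ⟨ exp x , p ⟩ ≈ eval p x
  ⟨exp,p⟩≈eval x p = begin
    ⟨ exp x , p ⟩
      ≈⟨ pair-taylor (length p) (exp x) p ⟩
    pair (length p) (λ k → (k !) · exp x k) (coeff p)
      ≈⟨ pair-cong (length p) (λ k → (k !) · exp x k) (x ^_) (coeff p) (coeff p)
           (λ k → n!·[x/n!]≈x k (x ^ k)) (λ _ → refl) ⟩
    pair (length p) (x ^_) (coeff p)
      ≈⟨ eval-as-pair p x ⟨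
    eval p x ∎

  pair-monomial : ∀ n f → pair (length (monomial n)) f (coeff (monomial n)) ≈ f n
  pair-monomial zero    f = trans (+-identityʳ _) (*-identityʳ _)
  pair-monomial (suc n) f = trans (+-cong (zeroʳ _) (pair-monomial n (f ∘ suc))) (+-identityˡ _)

  ⟨f,monomial⟩ : ∀ f n → ⟨ f , monomial n ⟩ ≈ (n !) · f n
  ⟨f,monomial⟩ f n = trans
    (pair-taylor (length (monomial n)) f (monomial n))
    (pair-monomial n (λ k → (k !) · f k))

  -- Umbral values as coefficients of composite series

  umbral-as-coeff : ∀ ψ f n → umbral ψ f n ≈ (n !) · (f ∘ₛ ψ) n
  umbral-as-coeff ψ f n = trans ([f⟨D⟩p]₀≈⟨f,p⟩ (f ∘ₛ ψ) (monomial n)) (⟨f,monomial⟩ (f ∘ₛ ψ) n)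

  e-as-∘ₛ : ∀ ψ x → e ψ x ≈ₛ exp x ∘ₛ ψ
  e-as-∘ₛ ψ x n = trans (*-congʳ (umbral-as-coeff ψ (exp x) n)) ([n!·x]/n!≈x n _)

  -- Composition with `ψ` respects products, so the functional equation of `exp` carries over.
  e-*ₛ : ∀ ψ → ψ 0 ≈ 0# → ∀ x y → e ψ x *ₛ e ψ y ≈ₛ e ψ (x + y)
  e-*ₛ ψ ψ₀≈0 x y n = begin
    (e ψ x *ₛ e ψ y) n
      ≈⟨ *ₛ-cong-≤ (e ψ x) (exp x ∘ₛ ψ) (e ψ y) (exp y ∘ₛ ψ) n (e-as-∘ₛ ψ x) (λ m _ → e-as-∘ₛ ψ y m) ⟩
    ((exp x ∘ₛ ψ) *ₛ (exp y ∘ₛ ψ)) n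
      ≈⟨ ∘ₛ-*ₛ ψ ψ₀≈0 (exp x) (exp y) n ⟨
    ((exp x *ₛ exp y) ∘ₛ ψ) n
      ≈⟨ ∘ₛ-congˡ ψ ψ₀≈0 (exp x *ₛ exp y) (exp (x + y)) (exp-*ₛ x y) n ⟩
    (exp (x + y) ∘ₛ ψ) n                 ≈⟨ e-as-∘ₛ ψ (x + y) n ⟨
    e ψ (x + y) n                        ∎

  -- Pairing with the poweroids

  module _ (φ : Series) (φ₀≈0 : φ 0 ≈ 0#) (pow : ℕ → Poly) (isPoweroids : IsPoweroids φ pow) where
    open IsPoweroids isPoweroids

    ⟨f∘φ,pow⟩ : ∀ n f → ⟨ f ∘ₛ φ , pow n ⟩ ≈ (n !) · f n
    ⟨f∘φ,pow⟩ zero f = begin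
      ⟨ f ∘ₛ φ , pow 0 ⟩          ≈⟨ ⟨,⟩-congʳ (f ∘ₛ φ) (pow 0) (1# ∷ []) pow-zero ⟩
      (f ∘ₛ φ) 0 * (1 · 1#) + 0#  ≈⟨ +-congʳ (*-cong (∘ₛ-zero φ φ₀≈0 f) (×-homo-1 1#)) ⟩
      f 0 * 1# + 0#               ≈⟨ +-congʳ (*-identityʳ _) ⟩
      1 · f 0                     ∎
    ⟨f∘φ,pow⟩ (suc n) f = begin
      ⟨ f ∘ₛ φ , p ⟩
        ≈⟨ ⟨,⟩-congˡ (f ∘ₛ φ) _ p (∘ₛ-horner φ φ₀≈0 f) ⟩
      ⟨ (λ m → f 0 * oneₛ m + (φ *ₛ f′ ∘ₛ φ) m) , p ⟩
        ≈⟨ pair-distribʳ (length p) (f 0) oneₛ (φ *ₛ f′ ∘ₛ φ) (taylor p) ⟩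
      f 0 * ⟨ oneₛ , p ⟩ + ⟨ φ *ₛ f′ ∘ₛ φ , p ⟩
        -- The constant term of `f` meets the value of the poweroid at zero, which vanishes; in the
        -- other term the factor `φ` moves across the pairing and becomes the lowering operator.
        ≈⟨ +-cong (*-congˡ (trans (⟨1,p⟩≈p₀ p) (trans (sym (eval-zero p)) (at-zero n))))
                  (⟨,⟩-adjoint φ (f′ ∘ₛ φ) p) ⟩
      f 0 * 0# + ⟨ f′ ∘ₛ φ , (φ ⟨D⟩) p ⟩
        ≈⟨ trans (+-congʳ (zeroʳ _)) (+-identityˡ _) ⟩
      ⟨ f′ ∘ₛ φ , (φ ⟨D⟩) p ⟩
        ≈⟨ ⟨,⟩-congʳ (f′ ∘ₛ φ) ((φ ⟨D⟩) p) ((suc n · 1#) *ₚ pow n) (lowering n) ⟩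
      ⟨ f′ ∘ₛ φ , (suc n · 1#) *ₚ pow n ⟩
        ≈⟨ ⟨,⟩-*ₚ (f′ ∘ₛ φ) (suc n · 1#) (pow n) ⟩
      (suc n · 1#) * ⟨ f′ ∘ₛ φ , pow n ⟩
        ≈⟨ *-congˡ (⟨f∘φ,pow⟩ n f′) ⟩
      (suc n · 1#) * ((n !) · f (suc n))
        ≈⟨ ·-as-* (suc n) _ ⟨
      suc n · ((n !) · f (suc n))
        ≈⟨ ×-assocˡ _ (suc n) (n !) ⟩
      (suc n !) · f (suc n) ∎
      where
      p  = pow (suc n)
      f′ = f ∘ suc

    umbral-exp : ∀ ψ → ψ 0 ≈ 0# → ψ ∘ₛ φ ≈ₛ tₛ → ∀ n x → umbral ψ (exp x) n ≈ eval (pow n) x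
    umbral-exp ψ ψ₀≈0 ψ∘φ≈t n x = begin
      umbral ψ (exp x) n                    ≈⟨ umbral-as-coeff ψ (exp x) n ⟩
      (n !) · (exp x ∘ₛ ψ) n                ≈⟨ ⟨f∘φ,pow⟩ n (exp x ∘ₛ ψ) ⟨
      ⟨ (exp x ∘ₛ ψ) ∘ₛ φ , pow n ⟩
        ≈⟨ ⟨,⟩-congˡ ((exp x ∘ₛ ψ) ∘ₛ φ) (exp x) (pow n)
             (∘ₛ-cancel φ ψ φ₀≈0 ψ₀≈0 ψ∘φ≈t (exp x)) ⟩
      ⟨ exp x , pow n ⟩                     ≈⟨ ⟨exp,p⟩≈eval x (pow n) ⟩
      eval (pow n) x                        ∎

  -- From the product rule for generating functions to the binomial identity

  binomial-property : ∀ (p : ℕ → Carrier → Carrier) →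
    (∀ x y → egf (λ n → p n x) *ₛ egf (λ n → p n y) ≈ₛ egf (λ n → p n (x + y))) →
    ∀ n x y → p n (x + y) ≈ ∑[ k ≤ n ] ((n C toℕ k) · (p (toℕ k) x * p (n ∸ toℕ k) y))
  binomial-property p egf-* n x y = begin
    p n (x + y)
      ≈⟨ n!·[x/n!]≈x n _ ⟨
    (n !) · egf (λ n → p n (x + y)) n
      ≈⟨ ×-congʳ (n !) (egf-* x y n) ⟨
    (n !) · (egf (λ n → p n x) *ₛ egf (λ n → p n y)) n
      ≈⟨ n!·egf-*ₛ (λ n → p n x) (λ n → p n y) n ⟩
    ∑[ k ≤ n ] ((n C toℕ k) · (p (toℕ k) x * p (n ∸ toℕ k) y)) ∎

mainTheorem5 : ∀ {c ℓ₁ ℓ₂} (K : HeytingField c ℓ₁ ℓ₂) (char0 : CharacteristicZero K) →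
    let open Poweroids K char0 in
    (φ φ⁻¹ : Series) → IsDelta φ → IsCompositionalInverse φ φ⁻¹ →
    (pow : ℕ → Poly) → IsPoweroids φ pow →
    (∀ x → e φ⁻¹ x ≈ₛ egf (λ n → eval (pow n) x))
    × (∀ x y → e φ⁻¹ x *ₛ e φ⁻¹ y ≈ₛ e φ⁻¹ (x + y))
    × (∀ n x y → eval (pow n) (x + y)
    ≈ ∑[ k ≤ n ] ((n C toℕ k) · (eval (pow (toℕ k)) x * eval (pow (n ∸ toℕ k)) y)))
mainTheorem5 K char0 φ φ⁻¹ isDelta isInverse pow isPoweroids =
    e≈egf-pow
  , e-*
  , binomial-property (λ n → eval (pow n)) λ x y n →
      -- The product rule, proved for `e φ⁻¹`, is transported to the generating function of the
      -- poweroids.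
      trans (*ₛ-cong-≤ (pows x) (e φ⁻¹ x) (pows y) (e φ⁻¹ y) n
               (λ m → sym (e≈egf-pow x m)) (λ m _ → sym (e≈egf-pow y m)))
            (trans (e-* x y n) (e≈egf-pow (x + y) n))
  where
  open Poweroids K char0
  open Umbral K char0
  open CommutativeRing commutativeRing using (sym; trans; *-congʳ)
  open IsDelta isDelta
  open IsCompositionalInverse isInverse

  pows : Carrier → Series
  pows x = egf (λ n → eval (pow n) x)

  e≈egf-pow : ∀ x → e φ⁻¹ x ≈ₛ pows x
  e≈egf-pow x n = *-congʳ (umbral-exp φ φ₀≈0 pow isPoweroids φ⁻¹ φ⁻¹₀≈0 inverseˡ n x)

  e-* : ∀ x y → e φ⁻¹ x *ₛ e φ⁻¹ y ≈ₛ e φ⁻¹ (x + y)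
  e-* = e-*ₛ φ⁻¹ φ⁻¹₀≈0
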